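{- Let $a>1$ be an integer, let $p$ be a prime, let $K \ge 1$ be an integer, and let $N = 2Kp^2+1$. Suppose that $2K < p$ and $2K < \log_a(2Kp^2+1)$. If $a^{N-1} \equiv 1 \pmod N$, then $N$ is prime. -}

module Defs where

open import Data.Nat as ℕ using (ℕ; zero; suc; _+_; _*_; _^_; _<_; _≤_; NonZero; z≤n; s≤s)
open import Data.Nat.Properties as ℕₚ
open import Data.Nat.Solver using (module +-*-Solver)
open import Data.Integer as ℤ using (ℤ; +_; -[1+_])
import Data.Integer.Properties as ℤₚ
import Data.Integer.Solver as ℤS
import Data.Integer.Divisibility as ℤ∣
open import Data.Rational.Unnormalised as ℚ using (ℚᵘ; mkℚᵘ; *<*; ↥_; ↧_; ↧ₙ_)
import Data.Rational.Unnormalised.Properties as ℚₚ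
open import Data.Product using (∃; _×_; _,_)
open import Data.Sum using (_⊎_; inj₁; inj₂)
open import Data.Empty using (⊥)
open import Relation.Nullary using (¬_; yes; no; contradiction)
open import Relation.Binary.Definitions using (tri<; tri≈; tri>)
open import Relation.Binary.PropositionalEquality
  using (_≡_; refl; sym; trans; cong; cong₂; subst; subst₂)

infix 4 _≡_[mod_]

_≡_[mod_] : ℕ → ℕ → ℕ → Set
x ≡ y [mod n ] = (+ n) ℤ∣.∣ (+ x ℤ.- + y)

-- Dedekind reals.  The cuts consist of unnormalised rationals; closure under
-- the strict order together with roundedness makes them respect _≃_.
record ℝ : Set₁ where
  field
    Lower     : ℚᵘ → Set
    Upper     : ℚᵘ → Set
    inhabited : ∃ Lower × ∃ Upper
    closedˡ   : ∀ {q r} → q ℚ.< r → Lower r → Lower q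
    closedʳ   : ∀ {q r} → q ℚ.< r → Upper q → Upper r
    roundedˡ  : ∀ {q} → Lower q → ∃ λ r → q ℚ.< r × Lower r
    roundedʳ  : ∀ {r} → Upper r → ∃ λ q → q ℚ.< r × Upper q
    disjoint  : ∀ {q} → Lower q → Upper q → ⊥
    located   : ∀ {q r} → q ℚ.< r → Lower q ⊎ Upper r

infix 4 _<ʳ_

_<ʳ_ : ℝ → ℝ → Set
x <ʳ y = ∃ λ q → ℝ.Upper x q × ℝ.Lower y q

fromℚ : ℚᵘ → ℝ
fromℚ p = record
  { Lower     = ℚ._< p
  ; Upper     = p ℚ.<_
  ; inhabited = (p ℚ.- ℚ.1ℚᵘ , p-1<p) , (p ℚ.+ ℚ.1ℚᵘ , p<p+1)
  ; closedˡ   = ℚₚ.<-trans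
  ; closedʳ   = λ q<r p<q → ℚₚ.<-trans p<q q<r
  ; roundedˡ  = λ q<p → let m , q<m , m<p = ℚₚ.<-dense q<p in m , q<m , m<p
  ; roundedʳ  = λ p<r → let m , p<m , m<r = ℚₚ.<-dense p<r in m , m<r , p<m
  ; disjoint  = ℚₚ.<-asym
  ; located   = locate
  }
  where
  p<p+1 : p ℚ.< p ℚ.+ ℚ.1ℚᵘ
  p<p+1 = ℚₚ.<-respˡ-≃ (ℚₚ.+-identityʳ p)
            (ℚₚ.+-monoʳ-< p (*<* (ℤ.+<+ (s≤s z≤n))))
  p-1<p : p ℚ.- ℚ.1ℚᵘ ℚ.< p
  p-1<p = ℚₚ.<-respʳ-≃ (ℚₚ.+-identityʳ p) (ℚₚ.+-monoʳ-< p (*<* ℤ.-<+))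
  locate : ∀ {q r} → q ℚ.< r → q ℚ.< p ⊎ p ℚ.< r
  locate {q} q<r with ℚₚ.<-cmp q p
  ... | tri< q<p _ _ = inj₁ q<p
  ... | tri≈ _ q≃p _ = inj₂ (ℚₚ.<-respˡ-≃ q≃p q<r)
  ... | tri> _ _ p<q = inj₂ (ℚₚ.<-trans p<q q<r)

fromℕ : ℕ → ℝ
fromℕ n = fromℚ (mkℚᵘ (+ n) 0)

_⁺ _⁻ : ℤ → ℕ
(+ n)    ⁺ = n
-[1+ n ] ⁺ = 0
(+ n)    ⁻ = 0
-[1+ n ] ⁻ = suc n

-- For q = n/d with d > 0, the real inequality a^q < x says a^n < x^d, that is,
-- a^(n⁺) < a^(n⁻) · x^d.
module _ (a x : ℕ) where

  LogLower LogUpper : ℚᵘ → Set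
  LogLower q = a ^ ((↥ q) ⁺) < a ^ ((↥ q) ⁻) * x ^ (↧ₙ q)
  LogUpper q = a ^ ((↥ q) ⁻) * x ^ (↧ₙ q) < a ^ ((↥ q) ⁺)

private

  Diff : ℤ → ℕ → ℕ → Set
  Diff n i j = n ℤ.+ + j ≡ + i

  ⁺⁻-diff : ∀ n → Diff n (n ⁺) (n ⁻)
  ⁺⁻-diff (+ n)    = cong +_ (ℕₚ.+-identityʳ n)
  ⁺⁻-diff -[1+ n ] = ℤₚ.n⊖n≡0 (suc n)

  diff-≤ : ∀ {m n i j k l} d e → Diff m i j → Diff n k l →
           m ℤ.* + e ℤ.≤ n ℤ.* + d → i * e + l * d ≤ k * d + j * e
  diff-≤ {m} {n} {i} {j} {k} {l} d e p q le =
    ℤₚ.drop‿+≤+ (subst₂ ℤ._≤_ (left m i p) (right n k q)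
      (ℤₚ.+-monoˡ-≤ (+ j ℤ.* + e ℤ.+ + l ℤ.* + d) le))
    where
    open ℤS.+-*-Solver
    cast : ∀ u v w z → + u ℤ.* + v ℤ.+ + w ℤ.* + z ≡ + (u * v + w * z)
    cast u v w z = cong₂ ℤ._+_ (sym (ℤₚ.pos-* u v)) (sym (ℤₚ.pos-* w z))
    left : ∀ m i → m ℤ.+ + j ≡ + i →
           m ℤ.* + e ℤ.+ (+ j ℤ.* + e ℤ.+ + l ℤ.* + d) ≡ + (i * e + l * d)
    left m i h = trans
      (solve 5 (λ m j e l d → m :* e :+ (j :* e :+ l :* d) :=
                              (m :+ j) :* e :+ l :* d) refl m (+ j) (+ e) (+ l) (+ d))
      (trans (cong (λ t → t ℤ.* + e ℤ.+ + l ℤ.* + d) h) (cast i e l d))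
    right : ∀ n k → n ℤ.+ + l ≡ + k →
            n ℤ.* + d ℤ.+ (+ j ℤ.* + e ℤ.+ + l ℤ.* + d) ≡ + (k * d + j * e)
    right n k h = trans
      (solve 5 (λ n j e l d → n :* d :+ (j :* e :+ l :* d) :=
                              (n :+ l) :* d :+ j :* e) refl n (+ j) (+ e) (+ l) (+ d))
      (trans (cong (λ t → t ℤ.* + d ℤ.+ + j ℤ.* + e) h) (cast k d j e))

  ^-cancelˡ-< : ∀ n {u v} → u ^ n < v ^ n → u < v
  ^-cancelˡ-< n h = ℕₚ.≰⇒> λ v≤u → ℕₚ.<⇒≱ h (ℕₚ.^-monoˡ-≤ n v≤u)

  ^-cancelʳ-≤ : ∀ a → 1 < a → ∀ {m n} → a ^ m ≤ a ^ n → m ≤ n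
  ^-cancelʳ-≤ a 1<a h = ℕₚ.≮⇒≥ λ n<m → ℕₚ.<⇒≱ (ℕₚ.^-monoʳ-< a 1<a n<m) h

  n<a^n : ∀ a → 1 < a → ∀ n → n < a ^ n
  n<a^n a 1<a zero    = s≤s z≤n
  n<a^n a 1<a (suc n) =
    ℕₚ.<-≤-trans (s≤s (n<a^n a 1<a n)) (ℕₚ.^-monoʳ-< a 1<a (ℕₚ.n<1+n n))

  *-^-distrib : ∀ u v n → (u * v) ^ n ≡ u ^ n * v ^ n
  *-^-distrib u v zero    = refl
  *-^-distrib u v (suc n) rewrite *-^-distrib u v n =
    solve 4 (λ u v s t → (u :* v) :* (s :* t) := (u :* s) :* (v :* t)) refl
      u v (u ^ n) (v ^ n)
    where open +-*-Solver

  bernoulli : ∀ A k → A ^ k * (A + k) ≤ suc A ^ k * A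
  bernoulli A zero    = ℕₚ.≤-reflexive (cong (_+ 0) (ℕₚ.+-identityʳ A))
  bernoulli A (suc k) = begin
    A ^ suc k * (A + suc k)                 ≤⟨ ℕₚ.m≤m+n _ (A ^ k * k) ⟩
    A ^ suc k * (A + suc k) + A ^ k * k     ≡⟨ solve 3 (λ A k s →
        (A :* s) :* (A :+ (con 1 :+ k)) :+ s :* k := (con 1 :+ A) :* (s :* (A :+ k)))
        refl A k (A ^ k) ⟩
    suc A * (A ^ k * (A + k))               ≤⟨ ℕₚ.*-monoʳ-≤ (suc A) (bernoulli A k) ⟩
    suc A * (suc A ^ k * A)                 ≡⟨ sym (ℕₚ.*-assoc (suc A) (suc A ^ k) A) ⟩
    suc A ^ suc k * A                       ∎
    where open ℕₚ.≤-Reasoning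
          open +-*-Solver

  power-gap : ∀ a {A B} .{{_ : NonZero A}} → A < B →
              a * A ^ suc (a * A) < B ^ suc (a * A)
  power-gap a {A} {B} A<B = ℕₚ.*-cancelʳ-< A _ _ (begin-strict
    a * A ^ k * A     ≡⟨ solve 3 (λ a s A → a :* s :* A := s :* (a :* A)) refl a (A ^ k) A ⟩
    A ^ k * (a * A)   <⟨ ℕₚ.*-monoʳ-< (A ^ k) {{ℕₚ.m^n≢0 A k}} (ℕₚ.m≤n+m k A) ⟩
    A ^ k * (A + k)   ≤⟨ bernoulli A k ⟩
    suc A ^ k * A     ≤⟨ ℕₚ.*-monoˡ-≤ A (ℕₚ.^-monoˡ-≤ k A<B) ⟩
    B ^ k * A         ∎)
    where open ℕₚ.≤-Reasoning
          open +-*-Solver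
          k : ℕ
          k = suc (a * A)

  module LogCut (a x : ℕ) (1<a : 1 < a) (1≤x : 1 ≤ x) where

    instance
      a≢0 : NonZero a
      a≢0 = ℕ.>-nonZero (ℕₚ.<-trans (s≤s z≤n) 1<a)

      x≢0 : NonZero x
      x≢0 = ℕ.>-nonZero 1≤x

    pow : ∀ j d n → (a ^ j * x ^ d) ^ n ≡ a ^ (j * n) * x ^ (d * n)
    pow j d n = trans (*-^-distrib (a ^ j) (x ^ d) n)
                      (cong₂ _*_ (ℕₚ.^-*-assoc a j n) (ℕₚ.^-*-assoc x d n))

    -- the two transports along (i - j)/d ≤ (k - l)/e
    lower-mono : ∀ i j k l d e .{{_ : NonZero d}} → i * e + l * d ≤ k * d + j * e →
                 a ^ k < a ^ l * x ^ e → a ^ i < a ^ j * x ^ d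
    lower-mono i j k l d e le h = ^-cancelˡ-< e (ℕₚ.*-cancelʳ-< (a ^ (l * d)) _ _ (begin-strict
      (a ^ i) ^ e * a ^ (l * d)                    ≡⟨ cong (_* a ^ (l * d)) (ℕₚ.^-*-assoc a i e) ⟩
      a ^ (i * e) * a ^ (l * d)                    ≡⟨ sym (ℕₚ.^-distribˡ-+-* a (i * e) (l * d)) ⟩
      a ^ (i * e + l * d)                          ≤⟨ ℕₚ.^-monoʳ-≤ a le ⟩
      a ^ (k * d + j * e)                          ≡⟨ ℕₚ.^-distribˡ-+-* a (k * d) (j * e) ⟩
      a ^ (k * d) * a ^ (j * e)                    ≡⟨ cong (_* a ^ (j * e)) (sym (ℕₚ.^-*-assoc a k d)) ⟩
      (a ^ k) ^ d * a ^ (j * e)                    <⟨ ℕₚ.*-monoˡ-< (a ^ (j * e)) {{ℕₚ.m^n≢0 a (j * e)}} (ℕₚ.^-monoˡ-< d h) ⟩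
      (a ^ l * x ^ e) ^ d * a ^ (j * e)            ≡⟨ cong (_* a ^ (j * e)) (pow l e d) ⟩
      a ^ (l * d) * x ^ (e * d) * a ^ (j * e)      ≡⟨ cong (λ t → a ^ (l * d) * x ^ t * a ^ (j * e)) (ℕₚ.*-comm e d) ⟩
      a ^ (l * d) * x ^ (d * e) * a ^ (j * e)      ≡⟨ solve 3 (λ u v w → u :* v :* w := w :* v :* u) refl (a ^ (l * d)) (x ^ (d * e)) (a ^ (j * e)) ⟩
      a ^ (j * e) * x ^ (d * e) * a ^ (l * d)      ≡⟨ cong (_* a ^ (l * d)) (sym (pow j d e)) ⟩
      (a ^ j * x ^ d) ^ e * a ^ (l * d)            ∎))
      where open ℕₚ.≤-Reasoning
            open +-*-Solver

    upper-mono : ∀ i j k l d e .{{_ : NonZero e}} → i * e + l * d ≤ k * d + j * e →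
                 a ^ j * x ^ d < a ^ i → a ^ l * x ^ e < a ^ k
    upper-mono i j k l d e le h = ^-cancelˡ-< d (ℕₚ.*-cancelʳ-< (a ^ (j * e)) _ _ (begin-strict
      (a ^ l * x ^ e) ^ d * a ^ (j * e)            ≡⟨ cong (_* a ^ (j * e)) (pow l e d) ⟩
      a ^ (l * d) * x ^ (e * d) * a ^ (j * e)      ≡⟨ cong (λ t → a ^ (l * d) * x ^ t * a ^ (j * e)) (ℕₚ.*-comm e d) ⟩
      a ^ (l * d) * x ^ (d * e) * a ^ (j * e)      ≡⟨ solve 3 (λ u v w → u :* v :* w := w :* v :* u) refl (a ^ (l * d)) (x ^ (d * e)) (a ^ (j * e)) ⟩
      a ^ (j * e) * x ^ (d * e) * a ^ (l * d)      ≡⟨ cong (_* a ^ (l * d)) (sym (pow j d e)) ⟩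
      (a ^ j * x ^ d) ^ e * a ^ (l * d)            <⟨ ℕₚ.*-monoˡ-< (a ^ (l * d)) {{ℕₚ.m^n≢0 a (l * d)}} (ℕₚ.^-monoˡ-< e h) ⟩
      (a ^ i) ^ e * a ^ (l * d)                    ≡⟨ cong (_* a ^ (l * d)) (ℕₚ.^-*-assoc a i e) ⟩
      a ^ (i * e) * a ^ (l * d)                    ≡⟨ sym (ℕₚ.^-distribˡ-+-* a (i * e) (l * d)) ⟩
      a ^ (i * e + l * d)                          ≤⟨ ℕₚ.^-monoʳ-≤ a le ⟩
      a ^ (k * d + j * e)                          ≡⟨ ℕₚ.^-distribˡ-+-* a (k * d) (j * e) ⟩
      a ^ (k * d) * a ^ (j * e)                    ≡⟨ cong (_* a ^ (j * e)) (sym (ℕₚ.^-*-assoc a k d)) ⟩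
      (a ^ k) ^ d * a ^ (j * e)                    ∎))
      where open ℕₚ.≤-Reasoning
            open +-*-Solver

    separated : ∀ i j k l d e → a ^ j * x ^ d ≤ a ^ i → a ^ k ≤ a ^ l * x ^ e →
                k * d + j * e ≤ i * e + l * d
    separated i j k l d e h₁ h₂ = ^-cancelʳ-≤ a 1<a (begin
      a ^ (k * d + j * e)                          ≡⟨ ℕₚ.^-distribˡ-+-* a (k * d) (j * e) ⟩
      a ^ (k * d) * a ^ (j * e)                    ≡⟨ cong (_* a ^ (j * e)) (sym (ℕₚ.^-*-assoc a k d)) ⟩
      (a ^ k) ^ d * a ^ (j * e)                    ≤⟨ ℕₚ.*-monoˡ-≤ (a ^ (j * e)) (ℕₚ.^-monoˡ-≤ d h₂) ⟩
      (a ^ l * x ^ e) ^ d * a ^ (j * e)            ≡⟨ cong (_* a ^ (j * e)) (pow l e d) ⟩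
      a ^ (l * d) * x ^ (e * d) * a ^ (j * e)      ≡⟨ cong (λ t → a ^ (l * d) * x ^ t * a ^ (j * e)) (ℕₚ.*-comm e d) ⟩
      a ^ (l * d) * x ^ (d * e) * a ^ (j * e)      ≡⟨ solve 3 (λ u v w → u :* v :* w := w :* v :* u) refl (a ^ (l * d)) (x ^ (d * e)) (a ^ (j * e)) ⟩
      a ^ (j * e) * x ^ (d * e) * a ^ (l * d)      ≡⟨ cong (_* a ^ (l * d)) (sym (pow j d e)) ⟩
      (a ^ j * x ^ d) ^ e * a ^ (l * d)            ≤⟨ ℕₚ.*-monoˡ-≤ (a ^ (l * d)) (ℕₚ.^-monoˡ-≤ e h₁) ⟩
      (a ^ i) ^ e * a ^ (l * d)                    ≡⟨ cong (_* a ^ (l * d)) (ℕₚ.^-*-assoc a i e) ⟩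
      a ^ (i * e) * a ^ (l * d)                    ≡⟨ sym (ℕₚ.^-distribˡ-+-* a (i * e) (l * d)) ⟩
      a ^ (i * e + l * d)                          ∎)
      where open ℕₚ.≤-Reasoning
            open +-*-Solver

    -- membership may be tested on any representation of the numerator as i - j
    lower-intro : ∀ q {i j} → Diff (↥ q) i j → a ^ i < a ^ j * x ^ (↧ₙ q) → LogLower a x q
    lower-intro q {i} {j} D = lower-mono ((↥ q) ⁺) ((↥ q) ⁻) i j (↧ₙ q) (↧ₙ q)
      (diff-≤ {↥ q} {↥ q} {j = (↥ q) ⁻} {l = j} (↧ₙ q) (↧ₙ q) (⁺⁻-diff (↥ q)) D ℤₚ.≤-refl)

    upper-intro : ∀ q {i j} → Diff (↥ q) i j → a ^ j * x ^ (↧ₙ q) < a ^ i → LogUpper a x q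
    upper-intro q {i} {j} D = upper-mono i j ((↥ q) ⁺) ((↥ q) ⁻) (↧ₙ q) (↧ₙ q)
      (diff-≤ {↥ q} {↥ q} {j = j} {l = (↥ q) ⁻} (↧ₙ q) (↧ₙ q) D (⁺⁻-diff (↥ q)) ℤₚ.≤-refl)

    order : ∀ {q r} → q ℚ.< r →
            (↥ q) ⁺ * ↧ₙ r + (↥ r) ⁻ * ↧ₙ q ≤ (↥ r) ⁺ * ↧ₙ q + (↥ q) ⁻ * ↧ₙ r
    order {q} {r} (*<* lt) =
      diff-≤ {↥ q} {↥ r} {j = (↥ q) ⁻} {l = (↥ r) ⁻} (↧ₙ q) (↧ₙ r) (⁺⁻-diff (↥ q)) (⁺⁻-diff (↥ r)) (ℤₚ.<⇒≤ lt)

    closedˡ : ∀ {q r} → q ℚ.< r → LogLower a x r → LogLower a x q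
    closedˡ {q} {r} q<r =
      lower-mono ((↥ q) ⁺) ((↥ q) ⁻) ((↥ r) ⁺) ((↥ r) ⁻) (↧ₙ q) (↧ₙ r) (order q<r)

    closedʳ : ∀ {q r} → q ℚ.< r → LogUpper a x q → LogUpper a x r
    closedʳ {q} {r} q<r =
      upper-mono ((↥ q) ⁺) ((↥ q) ⁻) ((↥ r) ⁺) ((↥ r) ⁻) (↧ₙ q) (↧ₙ r) (order q<r)

    located : ∀ {q r} → q ℚ.< r → LogLower a x q ⊎ LogUpper a x r
    located {q} {r} q<r
      with a ^ ((↥ q) ⁺) ℕ.<? a ^ ((↥ q) ⁻) * x ^ (↧ₙ q)
         | a ^ ((↥ r) ⁻) * x ^ (↧ₙ r) ℕ.<? a ^ ((↥ r) ⁺)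
    ... | yes l | _     = inj₁ l
    ... | no _  | yes u = inj₂ u
    ... | no ¬l | no ¬u = contradiction r≤q (ℚₚ.<⇒≱ q<r)
      where
      r≤q : r ℚ.≤ q
      r≤q = ℚ.*≤* (ℤₚ.≤-trans (ℤₚ.≤-reflexive shift)
              (ℤₚ.≤-trans (ℤₚ.+-monoˡ-≤ (ℤ.- (+ w)) (ℤ.+≤+ le))
                          (ℤₚ.≤-reflexive (sym shift′))))
        where
        open ℤS.+-*-Solver
        i = (↥ q) ⁺
        j = (↥ q) ⁻
        k = (↥ r) ⁺
        l = (↥ r) ⁻
        d = ↧ₙ q
        e = ↧ₙ r
        w : ℕ
        w = j * e + l * d
        le : k * d + j * e ≤ i * e + l * d
        le = separated i j k l d e (ℕₚ.≮⇒≥ ¬l) (ℕₚ.≮⇒≥ ¬u)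
        num : ∀ n → n ≡ + (n ⁺) ℤ.- + (n ⁻)
        num n = trans (solve 2 (λ n j → n := (n :+ j) :- j) refl n (+ (n ⁻)))
                      (cong (ℤ._- + (n ⁻)) (⁺⁻-diff n))
        cast : ∀ s t u v → + (s * t + u * v) ≡ + s ℤ.* + t ℤ.+ + u ℤ.* + v
        cast s t u v = cong₂ ℤ._+_ (ℤₚ.pos-* s t) (ℤₚ.pos-* u v)
        shift : ↥ r ℤ.* ↧ q ≡ + (k * d + j * e) ℤ.- + w
        shift = trans (cong (ℤ._* + d) (num (↥ r)))
          (trans (solve 5 (λ k l d j e → (k :- l) :* d :=
                    (k :* d :+ j :* e) :- (j :* e :+ l :* d)) refl (+ k) (+ l) (+ d) (+ j) (+ e))
            (sym (cong₂ ℤ._-_ (cast k d j e) (cast j e l d))))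
        shift′ : ↥ q ℤ.* ↧ r ≡ + (i * e + l * d) ℤ.- + w
        shift′ = trans (cong (ℤ._* + e) (num (↥ q)))
          (trans (solve 5 (λ i j e l d → (i :- j) :* e :=
                    (i :* e :+ l :* d) :- (j :* e :+ l :* d)) refl (+ i) (+ j) (+ e) (+ l) (+ d))
            (sym (cong₂ ℤ._-_ (cast i e l d) (cast j e l d))))

    -- n/d moved by ±1/(d(k + 1))
    refine : ℤ → ℚᵘ → ℕ → ℚᵘ
    refine s (mkℚᵘ n d) k = mkℚᵘ (n ℤ.* + suc k ℤ.+ s) (k + d * suc k)

    cross : ∀ s q k → ↥ (refine s q k) ℤ.* ↧ q ≡ ↥ q ℤ.* ↧ (refine s q k) ℤ.+ s ℤ.* ↧ q
    cross s (mkℚᵘ n d) k = trans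
      (solve 4 (λ n k s d → (n :* k :+ s) :* d := n :* (d :* k) :+ s :* d) refl
        n (+ suc k) s (+ suc d))
      (cong (λ t → n ℤ.* t ℤ.+ s ℤ.* + suc d) (sym (ℤₚ.pos-* (suc d) (suc k))))
      where open ℤS.+-*-Solver

    refine-> : ∀ q k → q ℚ.< refine (+ 1) q k
    refine-> q@(mkℚᵘ n d) k = *<* (subst₂ ℤ._<_ (ℤₚ.+-identityʳ (↥ q ℤ.* ↧ r)) (sym (cross (+ 1) q k))
      (ℤₚ.+-monoʳ-< (↥ q ℤ.* ↧ r) {+ 0} {+ 1 ℤ.* + suc d} (ℤ.+<+ (s≤s z≤n))))
      where r : ℚᵘ
            r = refine (+ 1) q k

    refine-< : ∀ q k → refine (-[1+ 0 ]) q k ℚ.< q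
    refine-< q@(mkℚᵘ n d) k = *<* (subst₂ ℤ._<_ (sym (cross -[1+ 0 ] q k)) (ℤₚ.+-identityʳ (↥ q ℤ.* ↧ r))
      (ℤₚ.+-monoʳ-< (↥ q ℤ.* ↧ r) { -[1+ 0 ] ℤ.* + suc d} {+ 0} ℤ.-<+))
      where r : ℚᵘ
            r = refine -[1+ 0 ] q k

    diff-* : ∀ n k → n ℤ.* + k ℤ.+ + ((n ⁻) * k) ≡ + ((n ⁺) * k)
    diff-* n k = trans (cong (λ t → n ℤ.* + k ℤ.+ t) (ℤₚ.pos-* (n ⁻) k))
      (trans (sym (ℤₚ.*-distribʳ-+ (+ k) n (+ (n ⁻))))
        (trans (cong (ℤ._* + k) (⁺⁻-diff n)) (sym (ℤₚ.pos-* (n ⁺) k))))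

    roundedˡ : ∀ {q} → LogLower a x q → ∃ λ r → q ℚ.< r × LogLower a x r
    roundedˡ {q@(mkℚᵘ n d)} h = refine (+ 1) q k , refine-> q k ,
      lower-intro (refine (+ 1) q k) {suc (i * suc k)} {j * suc k} D
        (subst₂ _<_ (cong (a *_) (ℕₚ.^-*-assoc a i (suc k))) (pow j (suc d) (suc k))
          (power-gap a {A} {{ℕₚ.m^n≢0 a i}} h))
      where
      i = n ⁺
      j = n ⁻
      A = a ^ i
      k = a * A
      D : (n ℤ.* + suc k ℤ.+ + 1) ℤ.+ + (j * suc k) ≡ + suc (i * suc k)
      D = trans (solve 2 (λ s t → (s :+ con (+ 1)) :+ t := con (+ 1) :+ (s :+ t)) refl
                  (n ℤ.* + suc k) (+ (j * suc k)))
                (cong (λ t → + 1 ℤ.+ t) (diff-* n (suc k)))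
        where open ℤS.+-*-Solver

    roundedʳ : ∀ {r} → LogUpper a x r → ∃ λ q → q ℚ.< r × LogUpper a x q
    roundedʳ {r@(mkℚᵘ n d)} h = refine -[1+ 0 ] r k , refine-< r k ,
      upper-intro (refine -[1+ 0 ] r k) {i * suc k} {suc (j * suc k)} D
        (subst₂ _<_
          (trans (cong (a *_) (pow j (suc d) (suc k)))
                 (sym (ℕₚ.*-assoc a (a ^ (j * suc k)) (x ^ (suc d * suc k)))))
          (ℕₚ.^-*-assoc a i (suc k))
          (power-gap a {A} {{A≢0}} h))
      where
      i = n ⁺
      j = n ⁻
      A = a ^ j * x ^ suc d
      A≢0 : NonZero A
      A≢0 = ℕₚ.m*n≢0 (a ^ j) (x ^ suc d) {{ℕₚ.m^n≢0 a j}} {{ℕₚ.m^n≢0 x (suc d)}}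
      k = a * A
      D : (n ℤ.* + suc k ℤ.+ -[1+ 0 ]) ℤ.+ + suc (j * suc k) ≡ + (i * suc k)
      D = trans (solve 2 (λ s t → (s :+ con -[1+ 0 ]) :+ (con (+ 1) :+ t) := s :+ t) refl
                  (n ℤ.* + suc k) (+ (j * suc k)))
                (diff-* n (suc k))
        where open ℤS.+-*-Solver

    inhabitedˡ : ∃ (LogLower a x)
    inhabitedˡ = mkℚᵘ -[1+ 0 ] 0 , ℕₚ.<-≤-trans 1<a
      (subst₂ (λ s t → a ≤ s * t) (sym (ℕₚ.*-identityʳ a)) (sym (ℕₚ.*-identityʳ x)) (ℕₚ.m≤m*n a x))

    inhabitedʳ : ∃ (LogUpper a x)
    inhabitedʳ = mkℚᵘ (+ x) 0 ,
      subst (_< a ^ x) (sym (trans (ℕₚ.*-identityˡ (x ^ 1)) (ℕₚ.*-identityʳ x))) (n<a^n a 1<a x)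

-- The logarithm of x to base a as a real number: its lower cut is
-- { q ∣ a^q < x } and its upper cut { q ∣ x < a^q }.
log : (a x : ℕ) → 1 < a → 1 ≤ x → ℝ
log a x 1<a 1≤x = record
  { Lower     = LogLower a x
  ; Upper     = LogUpper a x
  ; inhabited = inhabitedˡ , inhabitedʳ
  ; closedˡ   = λ {q} {r} → closedˡ {q} {r}
  ; closedʳ   = λ {q} {r} → closedʳ {q} {r}
  ; roundedˡ  = λ {q} → roundedˡ {q}
  ; roundedʳ  = λ {r} → roundedʳ {r}
  ; disjoint  = ℕₚ.<-asym
  ; located   = λ {q} {r} → located {q} {r}
  }
  where open LogCut a x 1<a 1≤x

{-# OPTIONS --safe #-}
-- Let M = 2K and b = aᴹ.  The logarithmic hypothesis says b < N, so N ∤ b - 1, while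
-- N ∣ b^(p²) - 1 = (b - 1)(1 + b + ⋯ + b^(p²-1)).  Hence some prime q divides both N
-- and the geometric sum.  If b ≡ 1 (mod q), the sum is ≡ p², so q divides both
-- N - 1 = Mp² and N, which is absurd; thus b ≢ 1 (mod q), and comparing
-- b^(p²) ≡ 1 with Fermat's b^(q-1) ≡ 1 gives p ∣ q - 1.
-- Now N = (1 + tp)(1 + sp) with q = 1 + sp, so s + t + stp = Mp.  If t > 0, then
-- p ∣ s + t forces M ≥ 1 + st ≥ s + t ≥ p, contradicting M < p; so t = 0 and N = q.
module Submission where

open import Defs
open import Data.Nat
  using (ℕ; zero; suc; _+_; _*_; _∸_; _^_; _<_; _≤_; z≤n; s≤s; NonZero; >-nonZero; ≢-nonZero)
open import Data.Nat.Properties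
open import Data.Nat.Combinatorics using (_C_; nCn≡1; nCk+nC[k+1]≡[n+1]C[k+1]; nC1≡n; k>n⇒nCk≡0)
open import Data.Nat.Coprimality using (Coprime; coprime-Bézout; coprime-divisor; gcd≡1⇒coprime)
open import Data.Nat.Divisibility
open import Data.Nat.DivMod using (_%_; _/_; m≡m%n+[m/n]*n; %-distribˡ-+; %-distribˡ-*; %-remove-+ʳ)
open import Data.Nat.GCD using (gcd; gcd[m,n]∣m; gcd[m,n]∣n; gcd[m,n]≢0; module Bézout)
open import Data.Nat.Primality
  using (Prime; prime⇒nonZero; prime⇒irreducible; ¬prime[1]; euclidsLemma)
open import Data.Nat.Primality.Factorisation using (factorise; PrimeFactorisation)
open import Data.Nat.Solver using (module +-*-Solver)
open import Data.Fin using (Fin; zero; suc; toℕ; inject₁)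
open import Data.Fin.Properties using (toℕ-fromℕ; toℕ-inject₁; toℕ<n)
import Data.Integer as ℤ
open import Data.List using ([]; _∷_)
open import Data.List.Relation.Unary.All using (_∷_)
open import Data.Nat.ListAction using (product)
open import Data.Product using (∃; _×_; _,_)
open import Data.Rational.Unnormalised using (mkℚᵘ)
open import Data.Sum using (_⊎_; inj₁; inj₂)
open import Data.Vec.Functional using (init; last)
open import Function using (_∘_)
open import Relation.Nullary using (¬_; yes; no; contradiction)
open import Relation.Binary.PropositionalEquality
  using (_≡_; _≢_; refl; sym; trans; cong; cong₂; subst; subst₂; module ≡-Reasoning)
import Algebra.Properties.Semiring.Exp +-*-semiring as Exp
import Algebra.Properties.Semiring.Mult +-*-semiring as Mult
open import Algebra.Properties.Semiring.Sum +-*-semiring using (sum; sum-cong-≗; sum-init-last)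
open import Algebra.Properties.CommutativeSemiring.Binomial +-*-commutativeSemiring
  using () renaming (theorem to binomial-theorem)
open +-*-Solver using (solve; con; _:=_; _:+_; _:*_)

-- Prime divisors and coprimality.

∃-prime-divisor : ∀ {n} .{{_ : NonZero n}} → n ≢ 1 → ∃ λ q → Prime q × q ∣ n
∃-prime-divisor {n} n≢1 with factorise n
... | record { factors = [] ; isFactorisation = n≡1 } = contradiction n≡1 n≢1
... | record { factors = q ∷ qs ; isFactorisation = n≡qΠ ; factorsPrime = q-prime ∷ _ } =
  q , q-prime , subst (q ∣_) (sym n≡qΠ) (m∣m*n (product qs))

prime∧∤⇒coprime : ∀ {p n} → Prime p → ¬ p ∣ n → Coprime p n
prime∧∤⇒coprime p-prime p∤n {d} (d∣p , d∣n) with prime⇒irreducible p-prime d∣p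
... | inj₁ d≡1  = d≡1
... | inj₂ refl = contradiction d∣n p∤n

-- Binomial coefficients modulo a prime.

C-absorption : ∀ n k → suc k * (suc n C suc k) ≡ suc n * (n C k)
C-absorption n zero = trans (cong (_+ 0) (nC1≡n (suc n))) (*-comm 1 (suc n))
C-absorption zero (suc k) = trans
  (cong (suc (suc k) *_) (k>n⇒nCk≡0 {1} {suc (suc k)} (s≤s (s≤s z≤n))))
  (*-zeroʳ (suc (suc k)))
C-absorption (suc n) (suc k) = begin
  suc (suc k) * (suc (suc n) C suc (suc k))
    ≡⟨ cong (suc (suc k) *_) (sym (nCk+nC[k+1]≡[n+1]C[k+1] (suc n) (suc k))) ⟩
  suc (suc k) * (u + v)
    -- One copy of `u` is set aside so that the remaining products are the left-hand sides for `k`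
    -- and `suc k`. Pascal's rule then turns their sum into `suc n * u`.
    ≡⟨ solve 3 (λ k u v → (con 1 :+ k) :* (u :+ v) := u :+ (k :* u :+ (con 1 :+ k) :* v)) refl (suc k) u v ⟩
  u + (suc k * u + suc (suc k) * v)
    ≡⟨ cong (u +_) (cong₂ _+_ (C-absorption n k) (C-absorption n (suc k))) ⟩
  u + (suc n * (n C k) + suc n * (n C suc k))
    ≡⟨ cong (u +_) (sym (*-distribˡ-+ (suc n) (n C k) (n C suc k))) ⟩
  u + suc n * (n C k + n C suc k)
    ≡⟨ cong (λ t → u + suc n * t) (nCk+nC[k+1]≡[n+1]C[k+1] n k) ⟩
  suc (suc n) * u ∎
  where
  open ≡-Reasoning
  u = suc n C suc k
  v = suc n C suc (suc k)

-- By absorption the prime divides `suc k * (suc n C suc k)`, and it is too large to divide `suc k`.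
prime∣C : ∀ {n k} → Prime (suc n) → k < n → suc n ∣ suc n C suc k
prime∣C {n} {k} q-prime k<n
  with euclidsLemma (suc k) (suc n C suc k) q-prime
         (subst (suc n ∣_) (sym (C-absorption n k)) (m∣m*n (n C k)))
... | inj₁ q∣k+1 = contradiction (∣⇒≤ q∣k+1) (<⇒≱ (s≤s k<n))
... | inj₂ q∣C   = q∣C

^-semiring : ∀ x n → x Exp.^ n ≡ x ^ n
^-semiring x zero    = refl
^-semiring x (suc n) = cong (x *_) (^-semiring x n)

×-semiring : ∀ n x → n Mult.× x ≡ n * x
×-semiring zero    x = refl
×-semiring (suc n) x = cong (x +_) (×-semiring n x)

binomial-suc : ∀ x n → suc x ^ n ≡ sum {suc n} (λ k → (n C toℕ k) * x ^ toℕ k)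
binomial-suc x n = begin
  suc x ^ n          ≡⟨ cong (_^ n) (+-comm 1 x) ⟩
  (x + 1) ^ n        ≡⟨ sym (^-semiring (x + 1) n) ⟩
  (x + 1) Exp.^ n    ≡⟨ binomial-theorem n x 1 ⟩
  sum {suc n} (λ k → (n C toℕ k) Mult.× (x Exp.^ toℕ k * 1 Exp.^ (n ∸ toℕ k)))
                     ≡⟨ sum-cong-≗ {suc n} (term ∘ toℕ) ⟩
  sum {suc n} (λ k → (n C toℕ k) * x ^ toℕ k) ∎
  where
  open ≡-Reasoning
  term : ∀ k → (n C k) Mult.× (x Exp.^ k * 1 Exp.^ (n ∸ k)) ≡ (n C k) * x ^ k
  term k = trans (×-semiring (n C k) _) (cong ((n C k) *_) (trans
    (cong₂ _*_ (^-semiring x k) (trans (^-semiring 1 (n ∸ k)) (^-zeroˡ (n ∸ k))))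
    (*-identityʳ (x ^ k))))

∣-sum : ∀ {q n} (t : Fin n → ℕ) → (∀ i → q ∣ t i) → q ∣ sum t
∣-sum {n = zero}  t q∣t = _ ∣0
∣-sum {n = suc n} t q∣t = ∣m∣n⇒∣m+n (q∣t zero) (∣-sum (t ∘ suc) (q∣t ∘ suc))

-- Congruences modulo `q` and coprime exponents.

module _ (q : ℕ) .{{_ : NonZero q}} where

  %-cong-* : ∀ {u v x y} → u % q ≡ v % q → x % q ≡ y % q → (u * x) % q ≡ (v * y) % q
  %-cong-* {u} {v} {x} {y} u≈v x≈y = trans (%-distribˡ-* u x q)
    (trans (cong₂ (λ s t → (s * t) % q) u≈v x≈y) (sym (%-distribˡ-* v y q)))

  %-cong-+ : ∀ {u v x y} → u % q ≡ v % q → x % q ≡ y % q → (u + x) % q ≡ (v + y) % q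
  %-cong-+ {u} {v} {x} {y} u≈v x≈y = trans (%-distribˡ-+ u x q)
    (trans (cong₂ (λ s t → (s + t) % q) u≈v x≈y) (sym (%-distribˡ-+ v y q)))

  %-cong-^ : ∀ {x y} n → x % q ≡ y % q → (x ^ n) % q ≡ (y ^ n) % q
  %-cong-^ zero    x≈y = refl
  %-cong-^ (suc n) x≈y = %-cong-* x≈y (%-cong-^ n x≈y)

  -- The equal remainders cancel and leave a difference of multiples of `q`. Truncation is harmless:
  -- for `x < y` the difference is 0.
  %≡⇒∣∸ : ∀ x y → x % q ≡ y % q → q ∣ x ∸ y
  %≡⇒∣∸ x y x≈y = subst (q ∣_) (sym (begin
    x ∸ y
      ≡⟨ cong₂ _∸_ (m≡m%n+[m/n]*n x q) (m≡m%n+[m/n]*n y q) ⟩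
    (x % q + x / q * q) ∸ (y % q + y / q * q)
      ≡⟨ cong (λ r → (r + x / q * q) ∸ (y % q + y / q * q)) x≈y ⟩
    (y % q + x / q * q) ∸ (y % q + y / q * q)
      ≡⟨ [m+n]∸[m+o]≡n∸o (y % q) _ _ ⟩
    x / q * q ∸ y / q * q
      ≡⟨ sym (*-distribʳ-∸ q (x / q) (y / q)) ⟩
    (x / q ∸ y / q) * q ∎)) (n∣m*n (x / q ∸ y / q))
    where open ≡-Reasoning

  ^≡1-* : ∀ x m n → (x ^ m) % q ≡ 1 % q → (x ^ (n * m)) % q ≡ 1 % q
  ^≡1-* x m n xᵐ≈1 = begin
    (x ^ (n * m)) % q  ≡⟨ cong (λ e → (x ^ e) % q) (*-comm n m) ⟩
    (x ^ (m * n)) % q  ≡⟨ cong (_% q) (sym (^-*-assoc x m n)) ⟩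
    ((x ^ m) ^ n) % q  ≡⟨ %-cong-^ n xᵐ≈1 ⟩
    (1 ^ n) % q        ≡⟨ cong (_% q) (^-zeroˡ n) ⟩
    1 % q              ∎
    where open ≡-Reasoning

  -- Multiplying `x ^ m` ≡ 1 by `x` gives `x` ≡ `x ^ suc m` ≡ 1.
  consecutive-exponents⇒≡1 : ∀ x {m n} → suc m ≡ n →
                             (x ^ m) % q ≡ 1 % q → (x ^ n) % q ≡ 1 % q → x % q ≡ 1 % q
  consecutive-exponents⇒≡1 x {m} refl xᵐ≈1 xxᵐ≈1 = trans (cong (_% q) (sym (*-identityʳ x)))
    (trans (sym (%-cong-* {x} {x} {x ^ m} {1} refl xᵐ≈1)) xxᵐ≈1)

  -- Bézout's identity over the naturals supplies a multiple of `m` and a multiple of `n` that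
  -- differ by one; its two constructors say which is larger.
  coprime-exponents⇒≡1 : ∀ x {m n} → Coprime m n →
                         (x ^ m) % q ≡ 1 % q → (x ^ n) % q ≡ 1 % q → x % q ≡ 1 % q
  coprime-exponents⇒≡1 x {m} {n} m⊥n xᵐ≈1 xⁿ≈1 with coprime-Bézout m⊥n
  ... | Bézout.+- i j eq = consecutive-exponents⇒≡1 x eq (^≡1-* x n j xⁿ≈1) (^≡1-* x m i xᵐ≈1)
  ... | Bézout.-+ i j eq = consecutive-exponents⇒≡1 x eq (^≡1-* x m i xᵐ≈1) (^≡1-* x n j xⁿ≈1)

-- Fermat's little theorem.

freshman : ∀ {n} → Prime (suc n) → ∀ x → (suc x ^ suc n) % suc n ≡ suc (x ^ suc n) % suc n
freshman {n} q-prime x = trans (cong (_% q) (begin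
  suc x ^ q
    ≡⟨ binomial-suc x q ⟩
  -- The leading 1 is the binomial term of index 0, split off by computation; `t` lists the others,
  -- ending with `x ^ q`.
  1 + sum t
    ≡⟨ cong suc (sum-init-last t) ⟩
  1 + (sum (init t) + last t)
    ≡⟨ cong suc (+-comm (sum (init t)) (last t)) ⟩
  1 + last t + sum (init t)
    ≡⟨ cong (λ u → suc u + sum (init t)) last≡ ⟩
  suc (x ^ q) + sum (init t) ∎))
  -- The coefficients in `init t` are the `q C suc k` with `k < n`, all divisible by `q`.
  (%-remove-+ʳ (suc (x ^ q)) (∣-sum (init t) λ i →
    ∣m⇒∣m*n _ (prime∣C q-prime (subst (_< n) (sym (toℕ-inject₁ i)) (toℕ<n i)))))
  where
  open ≡-Reasoning
  q = suc n
  t : Fin (suc n) → ℕ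
  t k = (q C suc (toℕ k)) * x ^ suc (toℕ k)
  last≡ : last t ≡ x ^ q
  last≡ = trans (cong (λ k → (q C suc k) * x ^ suc k) (toℕ-fromℕ n))
    (trans (cong (_* x ^ q) (nCn≡1 q)) (*-identityˡ (x ^ q)))

-- This form holds for every `x`, so induction can start at zero and step by `freshman`.
fermat : ∀ {n} → Prime (suc n) → ∀ x → (x ^ suc n) % suc n ≡ x % suc n
fermat q-prime zero    = refl
fermat {n} q-prime (suc x) = trans (freshman q-prime x)
  (%-cong-+ (suc n) {1} {1} {x ^ suc n} {x} refl (fermat q-prime x))

-- Geometric sums.

-- 1 + x + ⋯ + xⁿ⁻¹ for x = 1 + c
geometric : ℕ → ℕ → ℕ
geometric c zero    = 0
geometric c (suc n) = suc (suc c * geometric c n)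

geometric-closed : ∀ c n → suc (c * geometric c n) ≡ suc c ^ n
geometric-closed c zero    = cong suc (*-zeroʳ c)
geometric-closed c (suc n) = trans
  (solve 2 (λ c g → con 1 :+ c :* (con 1 :+ (con 1 :+ c) :* g)
                 := (con 1 :+ c) :* (con 1 :+ c :* g)) refl c (geometric c n))
  (cong (suc c *_) (geometric-closed c n))

-- The base `suc c` is 1 modulo `c`, so each of the `n` summands is 1 modulo `c` and the sum is `n`
-- plus a multiple of `c`.
∣geometric⇒∣n : ∀ {q c} → q ∣ c → ∀ n → q ∣ geometric c n → q ∣ n
∣geometric⇒∣n {q} {c} q∣c n q∣g = let r , eq = remainder n in
  ∣m+n∣m⇒∣n (subst (q ∣_) (trans eq (+-comm n (c * r))) q∣g) (∣m⇒∣m*n r q∣c)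
  where
  remainder : ∀ n → ∃ λ r → geometric c n ≡ n + c * r
  remainder zero    = 0 , sym (*-zeroʳ c)
  remainder (suc n) = let r , eq = remainder n in
    -- With g for `geometric c n`, the next sum is 1 + g + c g. The first g is expanded by
    -- induction, and c g joins the multiple of `c`.
    r + geometric c n , cong suc (trans (cong (_+ c * geometric c n) eq)
      (solve 4 (λ n c r g → n :+ c :* r :+ c :* g := n :+ c :* (r :+ g)) refl n c r (geometric c n)))

-- A prime divisor of N that is 1 modulo `p`.

prime∣q∸1 : ∀ {p n b} → Prime p → Prime (suc n) → (b ^ p ^ 2) % suc n ≡ 1 % suc n →
            ¬ b % suc n ≡ 1 % suc n → p ∣ n
prime∣q∸1 {p} {n} {b} p-prime q-prime bᵖᵖ≈1 b≉1 with p ∣? n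
... | yes p∣n = p∣n
... | no  p∤n = contradiction
  -- Coprimality of `p` and `n` is used twice: on the base `b ^ p`, lowering the exponent from p² to
  -- `p`, and then on `b` itself.
  (coprime-exponents⇒≡1 q b p⊥n
    (coprime-exponents⇒≡1 q (b ^ p) p⊥n bᵖ^p≈1 (bᵖ^n≈1 p)) bⁿ≈1) b≉1
  where
  open ≡-Reasoning
  q = suc n
  p⊥n = prime∧∤⇒coprime p-prime p∤n
  bᵖ^p≈1 : ((b ^ p) ^ p) % q ≡ 1 % q
  bᵖ^p≈1 = trans (cong (_% q) (trans (^-*-assoc b p p)
    (cong (λ e → b ^ (p * e)) (sym (*-identityʳ p))))) bᵖᵖ≈1
  -- b⁻¹ is b^(p²-1), which allows Fermat's b^q ≡ b to be divided by b.
  invertible : ∀ e .{{_ : NonZero e}} → (b ^ e) % q ≡ 1 % q → (b ^ n) % q ≡ 1 % q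
  invertible (suc e) bbᵉ≈1 = begin
    (b ^ n) % q              ≡⟨ cong (_% q) (sym (*-identityʳ (b ^ n))) ⟩
    (b ^ n * 1) % q          ≡⟨ %-cong-* q {b ^ n} {b ^ n} {1} {b * b ^ e} refl (sym bbᵉ≈1) ⟩
    (b ^ n * (b * b ^ e)) % q
      ≡⟨ cong (_% q) (solve 3 (λ u b v → u :* (b :* v) := b :* u :* v) refl (b ^ n) b (b ^ e)) ⟩
    (b ^ q * b ^ e) % q      ≡⟨ %-cong-* q {b ^ q} {b} {b ^ e} {b ^ e} (fermat q-prime b) refl ⟩
    (b * b ^ e) % q          ≡⟨ bbᵉ≈1 ⟩
    1 % q                    ∎
  bⁿ≈1 : (b ^ n) % q ≡ 1 % q
  bⁿ≈1 = invertible (p ^ 2) {{m^n≢0 p 2 {{prime⇒nonZero p-prime}}}} bᵖᵖ≈1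
  bᵖ^n≈1 : ∀ k → ((b ^ k) ^ n) % q ≡ 1 % q
  bᵖ^n≈1 k = trans (cong (_% q) (^-*-assoc b k n)) (^≡1-* q b n k bⁿ≈1)

∃-prime-divisor≡1 : ∀ {p M b} → Prime p → 1 < b → b < suc (M * p ^ 2) →
  suc (M * p ^ 2) ∣ b ^ p ^ 2 ∸ 1 → ∃ λ n → Prime (suc n) × suc n ∣ suc (M * p ^ 2) × p ∣ n
∃-prime-divisor≡1 {p} {M} {suc c@(suc _)} p-prime (s≤s _) (s≤s b≤N-1) N∣b^p²∸1 =
  from-gcd (∃-prime-divisor {gcd N S} gcd≢1)
  where
  N = suc (M * p ^ 2)
  b = suc c
  S = geometric c (p ^ 2)
  instance
    gcd≢0 : NonZero (gcd N S)
    gcd≢0 = ≢-nonZero (gcd[m,n]≢0 N S (inj₁ λ ()))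
  N∣cS : N ∣ c * S
  N∣cS = subst (N ∣_) (cong (_∸ 1) (sym (geometric-closed c (p ^ 2)))) N∣b^p²∸1
  gcd≢1 : gcd N S ≢ 1
  -- If the gcd were 1, then `N` would divide `c`, which is impossible as 0 < `c` < `N`; positivity
  -- of `c` comes from `1 < b`.
  gcd≢1 g≡1 = <⇒≱ (s≤s (<⇒≤ b≤N-1)) (∣⇒≤ (coprime-divisor {n = S} {o = c} (gcd≡1⇒coprime g≡1)
    (subst (N ∣_) (*-comm c S) N∣cS)))
  from-gcd : (∃ λ q → Prime q × q ∣ gcd N S) → ∃ λ n → Prime (suc n) × suc n ∣ N × p ∣ n
  from-gcd (zero  , q-prime , _)     = contradiction (prime⇒nonZero q-prime) λ ()
  from-gcd (suc n , q-prime , q∣gcd) = n , q-prime , q∣N ,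
    prime∣q∸1 p-prime q-prime b^p²≈1 b≉1
    where
    q = suc n
    q∣N : q ∣ N
    q∣N = ∣-trans q∣gcd (gcd[m,n]∣m N S)
    q∣S : q ∣ S
    q∣S = ∣-trans q∣gcd (gcd[m,n]∣n N S)
    b^p²≈1 : (b ^ p ^ 2) % q ≡ 1 % q
    b^p²≈1 = trans (cong (_% q) (sym (geometric-closed c (p ^ 2))))
      (%-remove-+ʳ 1 (∣n⇒∣m*n c q∣S))
    b≉1 : ¬ b % q ≡ 1 % q
    b≉1 b≈1 = ¬prime[1] (subst Prime (∣1⇒≡1 (∣m+n∣m⇒∣n
      (subst (q ∣_) (+-comm 1 (M * p ^ 2)) q∣N)
      (∣n⇒∣m*n M (∣geometric⇒∣n (%≡⇒∣∸ q b 1 b≈1) (p ^ 2) q∣S)))) q-prime)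

-- Factorisations of N into factors that are 1 modulo `p`.

factors≡1⇒trivial : ∀ {M p s t} .{{_ : NonZero p}} → M < p → suc (t * p) * suc (s * p) ≡ suc (M * p ^ 2) →
                    t ≡ 0 ⊎ s ≡ 0
factors≡1⇒trivial {t = zero}              M<p eq = inj₁ refl
factors≡1⇒trivial {s = zero}  {t = suc _} M<p eq = inj₂ refl
factors≡1⇒trivial {M} {p} {suc s} {suc t} M<p eq = contradiction M<p (≤⇒≯ p≤M)
  where
  open ≤-Reasoning
  S = suc s + suc t
  P = suc s * suc t
  -- Expand the product, remove the 1 on both sides and cancel one factor `p`.
  sum≡ : P * p + S ≡ M * p
  sum≡ = *-cancelʳ-≡ _ _ p (suc-injective (trans
    (solve 3 (λ s t p → con 1 :+ (s :* t :* p :+ (s :+ t)) :* p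
                     := (con 1 :+ t :* p) :* (con 1 :+ s :* p)) refl (suc s) (suc t) p)
    (trans eq (cong suc (solve 2 (λ M p → M :* (p :* (p :* con 1)) := M :* p :* p) refl M p)))))
  p≤S : p ≤ S
  p≤S = ∣⇒≤ (∣m+n∣m⇒∣n (subst (p ∣_) (sym sum≡) (n∣m*n M)) (n∣m*n P))
  -- The excess of `suc P` over `S` is exactly `s * t`.
  S≤P+1 : S ≤ suc P
  S≤P+1 = begin
    suc s + suc t        ≤⟨ m≤m+n (suc s + suc t) (s * t) ⟩
    suc s + suc t + s * t
      ≡⟨ solve 2 (λ s t → (con 1 :+ s) :+ (con 1 :+ t) :+ s :* t
                       := con 1 :+ (con 1 :+ s) :* (con 1 :+ t)) refl s t ⟩
    suc P                ∎
  p≤M : p ≤ M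
  p≤M = ≤-trans p≤S (≤-trans S≤P+1 (*-cancelʳ-≤ (suc P) M p (begin
    suc P * p   ≡⟨ +-comm p (P * p) ⟩
    P * p + p   ≤⟨ +-monoʳ-≤ (P * p) p≤S ⟩
    P * p + S   ≡⟨ sum≡ ⟩
    M * p       ∎)))

-- Modulo `p` both the product and the known factor are 1, which forces the cofactor to be 1 as
-- well.
cofactor≡1 : ∀ {p m s M} → m * suc (s * p) ≡ suc (M * p ^ 2) → ∃ λ t → m ≡ suc (t * p)
cofactor≡1 {p} {suc m} {s} {M} eq with ∣m+n∣m⇒∣n {m = suc m * s * p} {m}
    (subst (p ∣_) (suc-injective (trans (sym eq)
      (solve 3 (λ m s p → (con 1 :+ m) :* (con 1 :+ s :* p)
                       := con 1 :+ ((con 1 :+ m) :* s :* p :+ m)) refl m s p)))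
      (∣n⇒∣m*n M (m∣m*n (p * 1))))
    (n∣m*n (suc m * s))
... | divides t refl = t , refl

prime-criterion : ∀ {p M b} → Prime p → M < p → 1 < b → b < suc (M * p ^ 2) →
                  suc (M * p ^ 2) ∣ b ^ p ^ 2 ∸ 1 → Prime (suc (M * p ^ 2))
prime-criterion {p} {M} p-prime M<p 1<b b<N N∣b^p²∸1
  with ∃-prime-divisor≡1 {p} {M} p-prime 1<b b<N N∣b^p²∸1
... | _ , q-prime , divides m N≡mq , divides s refl
  with cofactor≡1 {p} {m} {s} {M} (sym N≡mq)
... | t , refl
  with factors≡1⇒trivial {M} {p} {s} {t} {{prime⇒nonZero p-prime}} M<p (sym N≡mq)
... | inj₁ refl = subst Prime (sym (trans N≡mq (*-identityˡ _))) q-prime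
-- Here `s` is 0, so the prime factor `suc (s * p)` would be 1.
... | inj₂ refl = contradiction q-prime ¬prime[1]

-- From the logarithm and the integer congruence to natural numbers.

<ʳlog⇒^< : ∀ {a x} (1<a : 1 < a) (1≤x : 1 ≤ x) n → fromℕ n <ʳ log a x 1<a 1≤x → a ^ n < x
<ʳlog⇒^< {a} {x} 1<a 1≤x n (q , n<q , q<log) = subst (a ^ n <_)
  (trans (*-identityˡ (x ^ 1)) (*-identityʳ x))
  -- The separating rational `q` is in the lower cut of the logarithm, hence so is the smaller n/1,
  -- whose membership reads `a ^ n < 1 * x ^ 1`.
  (ℝ.closedˡ (log a x 1<a 1≤x) {mkℚᵘ (ℤ.+ n) 0} {q} n<q q<log)

-- Once `x` is known to be a successor, the integer difference computes to the natural one, and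
-- integer divisibility is divisibility of absolute values.
≡1[mod]⇒∣∸1 : ∀ {n x} → 1 ≤ x → x ≡ 1 [mod n ] → n ∣ x ∸ 1
≡1[mod]⇒∣∸1 (s≤s _) n∣x-1 = n∣x-1

corollary3p2 : (a p K N : ℕ) (1<a : 1 < a) → Prime p → 1 ≤ K →
    N ≡ 2 * K * p ^ 2 + 1 → 2 * K < p →
    fromℕ (2 * K) <ʳ log a (2 * K * p ^ 2 + 1) 1<a (m≤n+m 1 (2 * K * p ^ 2)) →
    a ^ (N ∸ 1) ≡ 1 [mod N ] → Prime N
corollary3p2 a p K@(suc _) N 1<a p-prime 1≤K N≡ 2K<p 2K<log aᴺ⁻¹≡1 =
  subst Prime (sym N≡suc) (prime-criterion p-prime 2K<p
    (^-monoʳ-< a 1<a {0} {2 * K} (s≤s z≤n))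
    (subst (a ^ (2 * K) <_) (trans (sym N≡) N≡suc) (<ʳlog⇒^< 1<a (m≤n+m 1 (2 * K * p ^ 2)) (2 * K) 2K<log))
    -- After `N` is rewritten as a successor, `N ∸ 1` computes to `2 * K * p ^ 2`, so the power of
    -- `a` is the p²-th power of `a ^ (2 * K)`.
    (subst₂ (λ n x → n ∣ x ∸ 1) N≡suc
      (trans (cong (λ n → a ^ (n ∸ 1)) N≡suc) (sym (^-*-assoc a (2 * K) (p ^ 2))))
      (≡1[mod]⇒∣∸1 (m^n>0 a {{>-nonZero (<⇒≤ 1<a)}} (N ∸ 1)) aᴺ⁻¹≡1)))
  where
  N≡suc : N ≡ suc (2 * K * p ^ 2)
  N≡suc = trans N≡ (+-comm (2 * K * p ^ 2) 1)
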